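{- Let $G=(A,B,E)$ be a bipartite graph. Then the following assertions are true: (i) $d_c(G)=\delta_0(A)+\delta_0(B)$; (ii) $\alpha(G)=|A|+\delta_0(B)=|B|+\delta_0(A)=\mu(G)+\delta_0(A)+\delta_0(B)=\mu(G)+d_c(G)$; (iii) if $X$ is an $A$-critical set and $Y$ is a $B$-critical set, then $X\cup Y$ is a $d$-critical set; (iv) if $Z$ is a $d$-critical independent set, then $Z\cap A$ is an $A$-critical set and $Z\cap B$ is a $B$-critical set; (v) if $X$ is either an $A$-critical set or a $B$-critical set, then there is a matching from $N(X)$ into $X$.
   Context: All graphs are finite, undirected, without loops or multiple edges. $G=(A,B,E)$ denotes a bipartite graph with bipartition $\{A,B\}$, where $A\neq\emptyset\neq B$; its vertex set is $V=A\cup B$. For $X\subseteq V$, $N(X)=\{v\in V: v \text{ has a neighbor in } X\}$. A set of vertices is independent if no two of its vertices are adjacent; $\alpha(G)$ is the maximum size of an independent set, and $\mu(G)$ is the maximum size of a matching. For $X\subseteq V$ let $d(X)=|X|-|N(X)|$, with $d(\emptyset)=0$, and let $d_c(G)=\max\{d(X):X\subseteq V\}$. A set $U\subseteq V$ is $d$-critical if $d(U)=d_c(G)$; a $d$-critical independent set is a set that is both $d$-critical and independent. For $X\subseteq A$ or $X\subseteq B$ write $\delta(X)=d(X)$, and let $\delta_0(A)=\max\{\delta(X):X\subseteq A\}$, $\delta_0(B)=\max\{\delta(Y):Y\subseteq B\}$ (the empty set is allowed). A set $X\subseteq A$ is $A$-critical if $\delta(X)=\delta_0(A)$; a set $Y\subseteq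 B$ is $B$-critical if $\delta(Y)=\delta_0(B)$. For disjoint vertex sets $P,Q$, a matching from $P$ into $Q$ is a matching in which every vertex of $P$ is matched to a vertex of $Q$. -}

module Defs where

open import Data.Fin.Base using (Fin; _<_)
open import Data.Fin.Properties using (_≟_; _<?_; all?; any?)
open import Data.Fin.Subset using (Subset; inside; outside; _∈_; _⊆_; _∪_; _∩_; ∣_∣; ⊥; ⊤; Nonempty)
open import Data.Fin.Subset.Properties using (_∈?_; _⊆?_)
open import Data.Integer.Base as ℤ using (ℤ; +_)
import Data.Integer.Properties as ℤ
open import Data.List.Base as List using (List; []; _∷_; _++_; allFin; cartesianProduct; filter; length)
import Data.List.Extrema
import Data.List.Extrema.Nat as ExtremaNat
open import Data.Nat.Base using (ℕ; zero; suc)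
open import Data.Product.Base using (_×_; _,_; proj₁; proj₂; ∃-syntax)
open import Data.Sum.Base using (_⊎_)
import Data.Vec.Base as Vec
open import Level using (0ℓ)
open import Relation.Binary.Core using (Rel)
open import Relation.Binary.Definitions using (Symmetric; Irreflexive)
import Relation.Binary.Definitions as Binary
open import Relation.Binary.PropositionalEquality.Core using (_≡_)
open import Relation.Nullary.Decidable.Core using (does; _×-dec_; _⊎-dec_; _→-dec_; ¬?)
open import Relation.Nullary.Negation.Core using (¬_)
open import Relation.Unary using (Pred; Decidable)
open import Relation.Unary.Properties using (U?)

module ExtremaInt = Data.List.Extrema ℤ.≤-totalOrder

subsets : ∀ n → List (Subset n)
subsets zero    = Vec.[] ∷ []
subsets (suc n) = List.map (inside Vec.∷_) (subsets n) ++ List.map (outside Vec.∷_) (subsets n)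

-- In the two maxima below, the first argument of max is the value at the empty
-- set: they are the maxima over { X : P X } only for predicates P that hold of
-- the empty set, which is the case wherever they are used.

maxSize : ∀ {n} {P : Pred (Subset n) 0ℓ} → Decidable P → ℕ
maxSize {n} P? = ExtremaNat.max ∣ ⊥ {n} ∣ (List.map ∣_∣ (filter P? (subsets n)))

maxValue : ∀ {n} {P : Pred (Subset n) 0ℓ} → Decidable P → (Subset n → ℤ) → ℤ
maxValue {n} P? f = ExtremaInt.max (f ⊥) (List.map f (filter P? (subsets n)))

record Graph (n : ℕ) : Set₁ where
  field
    Adj    : Rel (Fin n) 0ℓ
    adj?   : Binary.Decidable Adj
    symm   : Symmetric Adj
    irrefl : Irreflexive _≡_ Adj

  N : Subset n → Subset n
  N X = Vec.tabulate λ v → does (any? λ u → (u ∈? X) ×-dec adj? v u)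

  Independent : Subset n → Set
  Independent X = ∀ u v → u ∈ X → v ∈ X → ¬ Adj u v

  independent? : Decidable Independent
  independent? X =
    all? λ u → all? λ v → (u ∈? X) →-dec ((v ∈? X) →-dec ¬? (adj? u v))

  α : ℕ
  α = maxSize independent?

  -- Each undirected edge {u , v} is listed once, as the pair with u < v.
  edges : List (Fin n × Fin n)
  edges = filter (λ (u , v) → (u <? v) ×-dec adj? u v)
                 (cartesianProduct (allFin n) (allFin n))

  Edge : Set
  Edge = Fin (length edges)

  EdgeSet : Set
  EdgeSet = Subset (length edges)

  ends : Edge → Fin n × Fin n
  ends = List.lookup edges

  Incident : Fin n → Edge → Set
  Incident v e = v ≡ proj₁ (ends e) ⊎ v ≡ proj₂ (ends e)

  incident? : Binary.Decidable Incident
  incident? v e = (v ≟ proj₁ (ends e)) ⊎-dec (v ≟ proj₂ (ends e))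

  Joins : Edge → Fin n → Fin n → Set
  Joins e u v = ends e ≡ (u , v) ⊎ ends e ≡ (v , u)

  IsMatching : EdgeSet → Set
  IsMatching M = ∀ e f → e ∈ M → f ∈ M → ∀ v → Incident v e → Incident v f → e ≡ f

  isMatching? : Decidable IsMatching
  isMatching? M =
    all? λ e → all? λ f → (e ∈? M) →-dec ((f ∈? M) →-dec
      (all? λ v → incident? v e →-dec (incident? v f →-dec (e ≟ f))))

  μ : ℕ
  μ = maxSize isMatching?

  MatchesInto : EdgeSet → Subset n → Subset n → Set
  MatchesInto M P Q =
    IsMatching M × (∀ p → p ∈ P → ∃[ q ] (q ∈ Q × (∃[ e ] (e ∈ M × Joins e p q))))

  d : Subset n → ℤ
  d X = + ∣ X ∣ ℤ.- + ∣ N X ∣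

  d-c : ℤ
  d-c = maxValue U? d

  DCritical : Subset n → Set
  DCritical U = d U ≡ d-c

  δ₀ : Subset n → ℤ
  δ₀ S = maxValue (_⊆? S) d

  -- For S one of the two sides of a bipartite graph, the S-critical sets.
  Critical : Subset n → Subset n → Set
  Critical S X = X ⊆ S × d X ≡ δ₀ S

record BipartiteGraph (n : ℕ) : Set₁ where
  field
    graph         : Graph n
  open Graph graph public
  field
    A B           : Subset n
    A-nonempty    : Nonempty A
    B-nonempty    : Nonempty B
    cover         : A ∪ B ≡ ⊤
    disjoint      : A ∩ B ≡ ⊥
    A-independent : Independent A
    B-independent : Independent B

-- Write δ for the maximum of d on a side. Neighbourhoods of the two sides are
-- disjoint, so d is additive over X = (X ∩ A) ∪ (X ∩ B); this gives (i), (iii), (iv).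
-- An A-critical X yields the maximum independent set I = X ∪ (B ∖ N X), whence
-- α = |B| + δ₀ A. If I is a maximum independent set and T ⊆ V ∖ I is independent, exchanging
-- T for N T ∩ I shows |T| ≤ |N T ∩ I|; adding this up over the two sides is
-- Hall's condition for matching V ∖ I into I. Hence α + μ = |V|, and for the I
-- above the same matching sends N X ⊆ B ∖ I into I ∩ A = X, which is (v).

module Submission where

open import Defs
open import Data.Fin.Subset using (_∪_; _∩_; ∣_∣)
open import Data.Integer.Base using (+_; _+_)
open import Data.Nat.Base using (ℕ)
open import Data.Product.Base using (_×_; ∃-syntax)
open import Data.Sum.Base using (_⊎_)
open import Relation.Binary.PropositionalEquality.Core using (_≡_)

open import Algebra.Properties.AbelianGroup using (∙-cancelˡ)
open import Data.Fin.Base using (Fin; zero; suc; _<_)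
open import Data.Fin.Properties using (_≟_; any?; suc-injective; <-cmp; <-asym)
open import Data.Fin.Subset using (Subset; inside; outside; _∈_; _∉_; _⊆_; ⊥; ⊤; ⁅_⁆; ∁; _-_; Nonempty)
open import Data.Fin.Subset.Properties
open import Data.Integer.Base as ℤ using (ℤ)
import Data.Integer.Properties as ℤ
import Data.Integer.Tactic.RingSolver as ℤ-Solver
open import Data.List.Base as List using (List; allFin; cartesianProduct; filter)
import Data.List.Extrema.Nat as ExtremaNat
import Data.List.Membership.Propositional as List
open import Data.List.Membership.Propositional.Properties
  using (∈-lookup; ∈-map⁺; ∈-map⁻; ∈-++⁺ˡ; ∈-++⁺ʳ; ∈-filter⁺; ∈-filter⁻; ∈-cartesianProduct⁺; ∈-allFin)
import Data.List.Relation.Unary.All as All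
import Data.List.Relation.Unary.AllPairs as AllPairs
open import Data.List.Relation.Unary.Any using (here; there; index)
open import Data.List.Relation.Unary.Any.Properties using (lookup-index)
open import Data.List.Relation.Unary.Unique.Propositional using (Unique)
open import Data.List.Relation.Unary.Unique.Propositional.Properties
  using (cartesianProduct⁺; allFin⁺; filter⁺)
open import Data.Nat.Base as ℕ using (zero; suc; s≤s; z≤n)
import Data.Nat.Properties as ℕ
open import Data.Product.Base using (_,_; proj₁; proj₂; uncurry)
open import Data.Product.Properties using (≡-dec)
open import Data.Sum.Base using (inj₁; inj₂; [_,_]′)
import Data.Vec.Base as Vec
open import Data.Vec.Properties using (lookup∘tabulate; []=⇒lookup; lookup⇒[]=)
open import Function.Base using (_∘_; id)
open import Level using (0ℓ)
open import Relation.Binary.Definitions using (tri<; tri≈; tri>)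
open import Relation.Binary.PropositionalEquality.Core using (refl; sym; trans; cong; cong₂; subst)
open import Relation.Binary.PropositionalEquality.Properties using (module ≡-Reasoning)
open import Relation.Nullary.Decidable.Core using (Dec; yes; no; does; _×-dec_; _⊎-dec_)
open import Relation.Nullary.Decidable using (dec-true)
open import Relation.Nullary.Negation.Core using (contradiction)
open import Relation.Unary using (Pred; Decidable)
open import Relation.Unary.Properties using (U?)

-- Cardinalities of finite subsets

Disjoint : ∀ {n} → Subset n → Subset n → Set
Disjoint p q = ∀ {x} → x ∈ p → x ∉ q

∣p∪q∣+∣p∩q∣≡∣p∣+∣q∣ : ∀ {n} (p q : Subset n) → ∣ p ∪ q ∣ ℕ.+ ∣ p ∩ q ∣ ≡ ∣ p ∣ ℕ.+ ∣ q ∣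
∣p∪q∣+∣p∩q∣≡∣p∣+∣q∣ Vec.[] Vec.[] = refl
∣p∪q∣+∣p∩q∣≡∣p∣+∣q∣ (outside Vec.∷ p) (outside Vec.∷ q) = ∣p∪q∣+∣p∩q∣≡∣p∣+∣q∣ p q
∣p∪q∣+∣p∩q∣≡∣p∣+∣q∣ (inside  Vec.∷ p) (outside Vec.∷ q) = cong suc (∣p∪q∣+∣p∩q∣≡∣p∣+∣q∣ p q)
∣p∪q∣+∣p∩q∣≡∣p∣+∣q∣ (outside Vec.∷ p) (inside  Vec.∷ q) =
  trans (cong suc (∣p∪q∣+∣p∩q∣≡∣p∣+∣q∣ p q)) (sym (ℕ.+-suc ∣ p ∣ ∣ q ∣))
∣p∪q∣+∣p∩q∣≡∣p∣+∣q∣ (inside  Vec.∷ p) (inside  Vec.∷ q) =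
  cong suc (trans (ℕ.+-suc ∣ p ∪ q ∣ ∣ p ∩ q ∣)
           (trans (cong suc (∣p∪q∣+∣p∩q∣≡∣p∣+∣q∣ p q)) (sym (ℕ.+-suc ∣ p ∣ ∣ q ∣))))

∣p∪q∣≤∣p∣+∣q∣ : ∀ {n} (p q : Subset n) → ∣ p ∪ q ∣ ℕ.≤ ∣ p ∣ ℕ.+ ∣ q ∣
∣p∪q∣≤∣p∣+∣q∣ p q = ℕ.≤-trans (ℕ.m≤m+n _ _) (ℕ.≤-reflexive (∣p∪q∣+∣p∩q∣≡∣p∣+∣q∣ p q))

disjoint⇒∣p∪q∣≡∣p∣+∣q∣ : ∀ {n} (p q : Subset n) → Disjoint p q → ∣ p ∪ q ∣ ≡ ∣ p ∣ ℕ.+ ∣ q ∣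
disjoint⇒∣p∪q∣≡∣p∣+∣q∣ {n} p q p#q = begin
  ∣ p ∪ q ∣                  ≡⟨ ℕ.+-identityʳ _ ⟨
  ∣ p ∪ q ∣ ℕ.+ 0            ≡⟨ cong (∣ p ∪ q ∣ ℕ.+_) (∣⊥∣≡0 n) ⟨
  ∣ p ∪ q ∣ ℕ.+ ∣ ⊥ {n} ∣    ≡⟨ cong (λ r → ∣ p ∪ q ∣ ℕ.+ ∣ r ∣) p∩q≡⊥ ⟨
  ∣ p ∪ q ∣ ℕ.+ ∣ p ∩ q ∣    ≡⟨ ∣p∪q∣+∣p∩q∣≡∣p∣+∣q∣ p q ⟩
  ∣ p ∣ ℕ.+ ∣ q ∣            ∎
  where
  open ≡-Reasoning
  p∩q≡⊥ : p ∩ q ≡ ⊥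
  p∩q≡⊥ = Empty-unique λ (x , x∈) → uncurry p#q (x∈p∩q⁻ p q x∈)

∣p∣≡∣p∩q∣+∣p∩∁q∣ : ∀ {n} (p q : Subset n) → ∣ p ∣ ≡ ∣ p ∩ q ∣ ℕ.+ ∣ p ∩ ∁ q ∣
∣p∣≡∣p∩q∣+∣p∩∁q∣ p q = begin
  ∣ p ∣                          ≡⟨ cong ∣_∣ (∩-identityʳ p) ⟨
  ∣ p ∩ ⊤ ∣                      ≡⟨ cong (λ r → ∣ p ∩ r ∣) (p∪∁p≡⊤ q) ⟨
  ∣ p ∩ (q ∪ ∁ q) ∣              ≡⟨ cong ∣_∣ (∩-distribˡ-∪ p q (∁ q)) ⟩
  ∣ (p ∩ q) ∪ (p ∩ ∁ q) ∣        ≡⟨ disjoint⇒∣p∪q∣≡∣p∣+∣q∣ _ _ (λ x∈ x∈′ →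
                                      x∈∁p⇒x∉p (proj₂ (x∈p∩q⁻ p _ x∈′)) (proj₂ (x∈p∩q⁻ p q x∈))) ⟩
  ∣ p ∩ q ∣ ℕ.+ ∣ p ∩ ∁ q ∣      ∎
  where open ≡-Reasoning

0<∣p∣⇒Nonempty : ∀ {n} {p : Subset n} → 0 ℕ.< ∣ p ∣ → Nonempty p
0<∣p∣⇒Nonempty {n} {p} 0<∣p∣ with nonempty? p
... | yes ne = ne
... | no  ¬ne = contradiction (subst (0 ℕ.<_) (trans (cong ∣_∣ (Empty-unique ¬ne)) (∣⊥∣≡0 n)) 0<∣p∣) λ ()

x∈p⇒⁅x⁆⊆p : ∀ {n} {x : Fin n} {p} → x ∈ p → ⁅ x ⁆ ⊆ p
x∈p⇒⁅x⁆⊆p x∈p y∈ = subst (_∈ _) (sym (x∈⁅y⁆⇒x≡y _ y∈)) x∈p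

∪-lub : ∀ {n} {p q r : Subset n} → p ⊆ r → q ⊆ r → p ∪ q ⊆ r
∪-lub {p = p} {q} p⊆r q⊆r x∈ = [ p⊆r , q⊆r ]′ (x∈p∪q⁻ p q x∈)

p⊆q∪[p∩∁q] : ∀ {n} (p q : Subset n) → p ⊆ q ∪ (p ∩ ∁ q)
p⊆q∪[p∩∁q] p q {x} x∈p with x ∈? q
... | yes x∈q = x∈p∪q⁺ (inj₁ x∈q)
... | no  x∉q = x∈p∪q⁺ (inj₂ (x∈p∩q⁺ (x∈p , x∉p⇒x∈∁p x∉q)))

∣p∩∁q∣<∣p∣ : ∀ {n} {p q : Subset n} {x} → x ∈ p → x ∈ q → ∣ p ∩ ∁ q ∣ ℕ.< ∣ p ∣
∣p∩∁q∣<∣p∣ {p = p} {q} x∈p x∈q =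
  p⊂q⇒∣p∣<∣q∣ (p∩q⊆p p (∁ q) , _ , x∈p , λ x∈ → x∈∁p⇒x∉p (proj₂ (x∈p∩q⁻ p _ x∈)) x∈q)

-- Induction on `p`: the image `y₀` chosen for the head is related to no later element, so `y₀` can
-- be deleted from `q` before recursing. Using a relation instead of a function lets an edge be
-- counted by any one of its suitable ends.
∣p∣≤∣q∣-via-leftUnique : ∀ {m n} (R : Fin m → Fin n → Set) {p : Subset m} {q : Subset n} →
  (∀ {x} → x ∈ p → ∃[ y ] (y ∈ q × R x y)) →
  (∀ {x x′ y} → R x y → R x′ y → x ≡ x′) →
  ∣ p ∣ ℕ.≤ ∣ q ∣
∣p∣≤∣q∣-via-leftUnique R {Vec.[]} total unique = z≤n
∣p∣≤∣q∣-via-leftUnique R {outside Vec.∷ p} total unique =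
  ∣p∣≤∣q∣-via-leftUnique (R ∘ suc) (total ∘ Vec.there) (λ r r′ → suc-injective (unique r r′))
∣p∣≤∣q∣-via-leftUnique R {inside Vec.∷ p} {q} total unique with total Vec.here
... | y₀ , y₀∈q , R0y₀ = ℕ.≤-trans
  (s≤s (∣p∣≤∣q∣-via-leftUnique (R ∘ suc) total′ (λ r r′ → suc-injective (unique r r′))))
  (x∈p⇒∣p-x∣<∣p∣ y₀∈q)
  where
  total′ : ∀ {x} → x ∈ p → ∃[ y ] (y ∈ (q - y₀) × R (suc x) y)
  total′ x∈p with total (Vec.there x∈p)
  ... | y , y∈q , Rxy = y , x∈p∧x≢y⇒x∈p-y y∈q (λ { refl → contradiction (unique R0y₀ Rxy) λ () }) , Rxy

-- Membership in tabulated subsets and attainment of maxima over all subsets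

∈-tabulate⁺ : ∀ {n} {P : Pred (Fin n) 0ℓ} (P? : Decidable P) {x} → P x → x ∈ Vec.tabulate (does ∘ P?)
∈-tabulate⁺ P? {x} Px = lookup⇒[]= x _ (trans (lookup∘tabulate _ x) (dec-true (P? x) Px))

∈-tabulate⁻ : ∀ {n} {P : Pred (Fin n) 0ℓ} (P? : Decidable P) {x} → x ∈ Vec.tabulate (does ∘ P?) → P x
∈-tabulate⁻ P? {x} x∈ with P? x | trans (sym (lookup∘tabulate (does ∘ P?) x)) ([]=⇒lookup x∈)
... | yes Px | _ = Px

lookup-injective : ∀ {A : Set} {xs : List A} → Unique xs →
  ∀ i j → List.lookup xs i ≡ List.lookup xs j → i ≡ j
lookup-injective (x∉xs AllPairs.∷ u) zero    zero    eq = refl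
lookup-injective (x∉xs AllPairs.∷ u) zero    (suc j) eq = contradiction eq (All.lookup x∉xs (∈-lookup j))
lookup-injective (x∉xs AllPairs.∷ u) (suc i) zero    eq = contradiction (sym eq) (All.lookup x∉xs (∈-lookup i))
lookup-injective (x∉xs AllPairs.∷ u) (suc i) (suc j) eq = cong suc (lookup-injective u i j eq)

∈-subsets : ∀ {n} (p : Subset n) → p List.∈ subsets n
∈-subsets Vec.[] = here refl
∈-subsets (inside  Vec.∷ p) = ∈-++⁺ˡ (∈-map⁺ (inside Vec.∷_) (∈-subsets p))
∈-subsets (outside Vec.∷ p) = ∈-++⁺ʳ _ (∈-map⁺ (outside Vec.∷_) (∈-subsets p))

module _ {n} {P : Pred (Subset n) 0ℓ} (P? : Decidable P) where

  ∣X∣≤maxSize : ∀ {X} → P X → ∣ X ∣ ℕ.≤ maxSize P?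
  ∣X∣≤maxSize PX = All.lookup (ExtremaNat.xs≤max ∣ ⊥ {n} ∣ _) (∈-map⁺ ∣_∣ (∈-filter⁺ P? (∈-subsets _) PX))

  maxSize-attained : P ⊥ → ∃[ X ] (P X × ∣ X ∣ ≡ maxSize P?)
  maxSize-attained P⊥ with ExtremaNat.argmax-sel id ∣ ⊥ {n} ∣ (List.map ∣_∣ (filter P? (subsets n)))
  -- The maximum may be the default value, which is the size of `⊥`; then `P⊥` supplies the witness.
  ... | inj₁ eq = ⊥ , P⊥ , sym eq
  ... | inj₂ ∈  with ∈-map⁻ ∣_∣ ∈
  ...   | X , X∈ , eq = X , proj₂ (∈-filter⁻ P? {xs = subsets n} X∈) , sym eq

  module _ (f : Subset n → ℤ) where

    fX≤maxValue : ∀ {X} → P X → f X ℤ.≤ maxValue P? f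
    fX≤maxValue PX = All.lookup (ExtremaInt.xs≤max (f ⊥) _) (∈-map⁺ f (∈-filter⁺ P? (∈-subsets _) PX))

    maxValue-attained : P ⊥ → ∃[ X ] (P X × f X ≡ maxValue P? f)
    maxValue-attained P⊥ with ExtremaInt.argmax-sel id (f ⊥) (List.map f (filter P? (subsets n)))
    ... | inj₁ eq = ⊥ , P⊥ , sym eq
    ... | inj₂ ∈  with ∈-map⁻ f ∈
    ...   | X , X∈ , eq = X , proj₂ (∈-filter⁻ P? {xs = subsets n} X∈) , sym eq

-- A strict inequality in the first summand would make the sums differ. This turns optimality of a
-- sum into optimality of each part, as (iv) requires.
+-tightˡ : ∀ {a b a′ b′} → a ℤ.≤ a′ → b ℤ.≤ b′ → a + b ≡ a′ + b′ → a ≡ a′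
+-tightˡ a≤a′ b≤b′ eq = ℤ.≤-antisym a≤a′ (ℤ.≮⇒≥ λ a<a′ → ℤ.<-irrefl eq (ℤ.+-mono-<-≤ a<a′ b≤b′))

-- Neighbourhoods and independent sets

module GraphProperties {n} (G : Graph n) where
  open Graph G

  ∈N⁺ : ∀ {X u v} → u ∈ X → Adj v u → v ∈ N X
  ∈N⁺ {X} u∈X vu = ∈-tabulate⁺ (λ v → any? λ u → (u ∈? X) ×-dec adj? v u) (_ , u∈X , vu)

  ∈N⁻ : ∀ {X v} → v ∈ N X → ∃[ u ] (u ∈ X × Adj v u)
  ∈N⁻ {X} = ∈-tabulate⁻ (λ v → any? λ u → (u ∈? X) ×-dec adj? v u)

  N-mono : ∀ {X Y} → X ⊆ Y → N X ⊆ N Y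
  N-mono X⊆Y v∈ with ∈N⁻ v∈
  ... | u , u∈X , vu = ∈N⁺ (X⊆Y u∈X) vu

  N-∪ : ∀ X Y → N (X ∪ Y) ≡ N X ∪ N Y
  N-∪ X Y = ⊆-antisym
    (λ v∈ → let u , u∈ , vu = ∈N⁻ v∈ in
      x∈p∪q⁺ ([ (λ u∈X → inj₁ (∈N⁺ u∈X vu)) , (λ u∈Y → inj₂ (∈N⁺ u∈Y vu)) ]′ (x∈p∪q⁻ X Y u∈)))
    (∪-lub (N-mono (p⊆p∪q Y)) (N-mono (q⊆p∪q X Y)))

  independent-⊆ : ∀ {X Y} → X ⊆ Y → Independent Y → Independent X
  independent-⊆ X⊆Y indY u v u∈ v∈ = indY u v (X⊆Y u∈) (X⊆Y v∈)

  -- Deleting `N T` from `S` removes every edge between `T` and what remains. It serves both to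
  -- modify a maximum independent set and to build one from a critical set.
  independent-exchange : ∀ T S → Independent T → Independent S → Independent (T ∪ (S ∩ ∁ (N T)))
  independent-exchange T S indT indS u v u∈ v∈ uv
    with x∈p∪q⁻ T _ u∈ | x∈p∪q⁻ T _ v∈
  ... | inj₁ u∈T | inj₁ v∈T = indT u v u∈T v∈T uv
  ... | inj₁ u∈T | inj₂ v∈S = x∈∁p⇒x∉p (proj₂ (x∈p∩q⁻ S _ v∈S)) (∈N⁺ u∈T (symm uv))
  ... | inj₂ u∈S | inj₁ v∈T = x∈∁p⇒x∉p (proj₂ (x∈p∩q⁻ S _ u∈S)) (∈N⁺ v∈T uv)
  ... | inj₂ u∈S | inj₂ v∈S = indS u v (p∩q⊆p S _ u∈S) (p∩q⊆p S _ v∈S) uv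

  ⊥-independent : Independent ⊥
  ⊥-independent u v u∈ = contradiction u∈ ∉⊥

  -- Hall's theorem

  -- A matching given by a partner function, which is easier to restrict and glue than an edge set.
  -- The function is total on `Fin n`; its values outside `P` are arbitrary.
  record MatchableInto (P Q : Subset n) : Set where
    field
      partner   : Fin n → Fin n
      adjacent  : ∀ {p} → p ∈ P → Adj p (partner p)
      into      : ∀ {p} → p ∈ P → partner p ∈ Q
      injective : ∀ {p p′} → p ∈ P → p′ ∈ P → partner p ≡ partner p′ → p ≡ p′

  HallCondition : Subset n → Subset n → Set
  HallCondition P Q = ∀ T → T ⊆ P → ∣ T ∣ ℕ.≤ ∣ N T ∩ Q ∣

  matchable-⁅⁆ : ∀ {p q} → Adj p q → MatchableInto ⁅ p ⁆ ⁅ q ⁆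
  matchable-⁅⁆ {p} {q} pq = record
    { partner   = λ _ → q
    ; adjacent  = λ x∈ → subst (λ x → Adj x q) (sym (x∈⁅y⁆⇒x≡y p x∈)) pq
    ; into      = λ _ → x∈⁅x⁆ q
    ; injective = λ x∈ y∈ _ → trans (x∈⁅y⁆⇒x≡y p x∈) (sym (x∈⁅y⁆⇒x≡y p y∈))
    }

  -- On the overlap of `P` and `P′` the partner from the first matching wins. Partners taken from
  -- different matchings cannot collide because `Q` and `Q′` are disjoint.
  matchable-∪ : ∀ {P P′ Q Q′} → Disjoint Q Q′ → MatchableInto P Q → MatchableInto P′ Q′ →
    MatchableInto (P ∪ P′) (Q ∪ Q′)
  matchable-∪ {P} {P′} {Q} {Q′} Q#Q′ m m′ = record
    { partner = h ; adjacent = h-adj ; into = h-into ; injective = h-inj }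
    where
    module F = MatchableInto m
    module F′ = MatchableInto m′

    h : Fin n → Fin n
    h x with x ∈? P
    ... | yes _ = F.partner x
    ... | no  _ = F′.partner x

    ∈P′ : ∀ {x} → x ∈ P ∪ P′ → x ∉ P → x ∈ P′
    ∈P′ x∈ x∉P = [ (λ x∈P → contradiction x∈P x∉P) , id ]′ (x∈p∪q⁻ P P′ x∈)

    h-adj : ∀ {x} → x ∈ P ∪ P′ → Adj x (h x)
    h-adj {x} x∈ with x ∈? P
    ... | yes x∈P = F.adjacent x∈P
    ... | no  x∉P = F′.adjacent (∈P′ x∈ x∉P)

    h-into : ∀ {x} → x ∈ P ∪ P′ → h x ∈ Q ∪ Q′
    h-into {x} x∈ with x ∈? P
    ... | yes x∈P = x∈p∪q⁺ (inj₁ (F.into x∈P))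
    ... | no  x∉P = x∈p∪q⁺ (inj₂ (F′.into (∈P′ x∈ x∉P)))

    h-inj : ∀ {x y} → x ∈ P ∪ P′ → y ∈ P ∪ P′ → h x ≡ h y → x ≡ y
    h-inj {x} {y} x∈ y∈ eq with x ∈? P | y ∈? P
    ... | yes x∈P | yes y∈P = F.injective x∈P y∈P eq
    ... | no  x∉P | no  y∉P = F′.injective (∈P′ x∈ x∉P) (∈P′ y∈ y∉P) eq
    ... | yes x∈P | no  y∉P =
      contradiction (F′.into (∈P′ y∈ y∉P)) (Q#Q′ (subst (_∈ Q) eq (F.into x∈P)))
    ... | no  x∉P | yes y∈P =
      contradiction (F′.into (∈P′ x∈ x∉P)) (Q#Q′ (subst (_∈ Q) (sym eq) (F.into y∈P)))

  matchable-mono : ∀ {P P′ Q Q′} → P′ ⊆ P → Q ⊆ Q′ → MatchableInto P Q → MatchableInto P′ Q′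
  matchable-mono P′⊆P Q⊆Q′ m = record
    { partner   = partner
    ; adjacent  = λ p∈ → adjacent (P′⊆P p∈)
    ; into      = λ p∈ → Q⊆Q′ (into (P′⊆P p∈))
    ; injective = λ p∈ p′∈ → injective (P′⊆P p∈) (P′⊆P p′∈)
    }
    where open MatchableInto m

  -- Hall's condition is applied to `T ∪ U`. Its neighbours in `Q` are those of `T`, at most `∣ T ∣`
  -- by tightness, and the neighbours of `U` that survive the deletion; cancelling `∣ T ∣` leaves
  -- the claim for `U`.
  hall-contract : ∀ {P Q T} → T ⊆ P → ∣ N T ∩ Q ∣ ℕ.≤ ∣ T ∣ → HallCondition P Q →
    HallCondition (P ∩ ∁ T) (Q ∩ ∁ (N T))
  hall-contract {P} {Q} {T} T⊆P tight hc U U⊆ = ℕ.+-cancelˡ-≤ ∣ T ∣ _ _ (begin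
    ∣ T ∣ ℕ.+ ∣ U ∣                                    ≡⟨ disjoint⇒∣p∪q∣≡∣p∣+∣q∣ T U T#U ⟨
    ∣ T ∪ U ∣                                          ≤⟨ hc (T ∪ U) (∪-lub T⊆P (p∩q⊆p P _ ∘ U⊆)) ⟩
    ∣ N (T ∪ U) ∩ Q ∣                                  ≤⟨ p⊆q⇒∣p∣≤∣q∣ covered ⟩
    ∣ (N T ∩ Q) ∪ (N U ∩ (Q ∩ ∁ (N T))) ∣              ≤⟨ ∣p∪q∣≤∣p∣+∣q∣ (N T ∩ Q) _ ⟩
    ∣ N T ∩ Q ∣ ℕ.+ ∣ N U ∩ (Q ∩ ∁ (N T)) ∣            ≤⟨ ℕ.+-monoˡ-≤ _ tight ⟩
    ∣ T ∣ ℕ.+ ∣ N U ∩ (Q ∩ ∁ (N T)) ∣                  ∎)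
    where
    open ℕ.≤-Reasoning
    T#U : Disjoint T U
    T#U x∈T x∈U = x∈∁p⇒x∉p (proj₂ (x∈p∩q⁻ P _ (U⊆ x∈U))) x∈T
    covered : N (T ∪ U) ∩ Q ⊆ (N T ∩ Q) ∪ (N U ∩ (Q ∩ ∁ (N T)))
    covered {x} x∈ with x∈p∩q⁻ (N (T ∪ U)) Q x∈
    ... | x∈N , x∈Q with x ∈? N T
    ...   | yes x∈NT = x∈p∪q⁺ (inj₁ (x∈p∩q⁺ (x∈NT , x∈Q)))
    ...   | no  x∉NT with x∈p∪q⁻ (N T) (N U) (subst (x ∈_) (N-∪ T U) x∈N)
    ...     | inj₁ x∈NT = contradiction x∈NT x∉NT
    ...     | inj₂ x∈NU = x∈p∪q⁺ (inj₂ (x∈p∩q⁺ (x∈NU , x∈p∩q⁺ (x∈Q , x∉p⇒x∈∁p x∉NT))))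

  -- Halmos–Vaughan: try to match some p to a neighbour q; if this violates the
  -- Hall condition at T, then T was tight, and T and P \ T can be matched separately.
  hall-bounded : ∀ k P Q → ∣ P ∣ ℕ.≤ k → HallCondition P Q → MatchableInto P Q
  hall-bounded k P Q ∣P∣≤k hc with nonempty? P
  ... | no empty = record
    { partner   = id
    ; adjacent  = λ p∈ → contradiction (_ , p∈) empty
    ; into      = λ p∈ → contradiction (_ , p∈) empty
    ; injective = λ p∈ → contradiction (_ , p∈) empty
    }
  hall-bounded zero P Q ∣P∣≤0 hc | yes (p , p∈P) =
    contradiction (ℕ.≤-trans (∣p∩∁q∣<∣p∣ p∈P p∈P) ∣P∣≤0) λ ()
  hall-bounded (suc k) P Q ∣P∣≤1+k hc | yes (p , p∈P)
    -- Hall's condition at the singleton `⁅ p ⁆` provides a neighbour of `p` in `Q`.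
    with 0<∣p∣⇒Nonempty (subst (ℕ._≤ ∣ N ⁅ p ⁆ ∩ Q ∣) (∣⁅x⁆∣≡1 p) (hc ⁅ p ⁆ (x∈p⇒⁅x⁆⊆p p∈P)))
  ... | q , q∈N∩Q with x∈p∩q⁻ (N ⁅ p ⁆) Q q∈N∩Q
  ...   | q∈N , q∈Q with ∈N⁻ q∈N
  ...     | p′ , p′∈ , qp′ = step (anySubset? λ T → (T ⊆? P′) ×-dec (∣ N T ∩ Q′ ∣ ℕ.<? ∣ T ∣))
    where
    P′ = P ∩ ∁ ⁅ p ⁆
    Q′ = Q ∩ ∁ ⁅ q ⁆

    pq : Adj p q
    pq = symm (subst (Adj q) (x∈⁅y⁆⇒x≡y p p′∈) qp′)

    ∣P′∣≤k : ∣ P′ ∣ ℕ.≤ k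
    ∣P′∣≤k = ℕ.s≤s⁻¹ (ℕ.≤-trans (∣p∩∁q∣<∣p∣ p∈P (x∈⁅x⁆ p)) ∣P∣≤1+k)

    step : Dec (∃[ T ] (T ⊆ P′ × ∣ N T ∩ Q′ ∣ ℕ.< ∣ T ∣)) → MatchableInto P Q
    step (no ¬violated) = matchable-mono (p⊆q∪[p∩∁q] P ⁅ p ⁆) (∪-lub (x∈p⇒⁅x⁆⊆p q∈Q) (p∩q⊆p Q _))
      (matchable-∪ (λ x∈ x∈′ → x∈∁p⇒x∉p (proj₂ (x∈p∩q⁻ Q _ x∈′)) x∈)
        (matchable-⁅⁆ pq)
        (hall-bounded k P′ Q′ ∣P′∣≤k (λ T T⊆ → ℕ.≮⇒≥ λ lt → ¬violated (T , T⊆ , lt))))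
    step (yes (T , T⊆P′ , violated)) =
      matchable-mono (p⊆q∪[p∩∁q] P T) (∪-lub (p∩q⊆q (N T) Q) (p∩q⊆p Q _))
      (matchable-∪ (λ x∈ x∈′ → x∈∁p⇒x∉p (proj₂ (x∈p∩q⁻ Q _ x∈′)) (p∩q⊆p (N T) Q x∈))
        (hall-bounded k T (N T ∩ Q) (ℕ.≤-trans (p⊆q⇒∣p∣≤∣q∣ T⊆P′) ∣P′∣≤k) hc-T)
        (hall-bounded k (P ∩ ∁ T) (Q ∩ ∁ (N T)) ∣P∩∁T∣≤k (hall-contract T⊆P tight hc)))
      where
      T⊆P : T ⊆ P
      T⊆P = p∩q⊆p P _ ∘ T⊆P′

      -- For `U ⊆ T` all neighbours of `U` already lie in `N T`, so shrinking the target to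
      -- `N T ∩ Q` loses none of them.
      hc-T : HallCondition T (N T ∩ Q)
      hc-T U U⊆T = ℕ.≤-trans (hc U (T⊆P ∘ U⊆T)) (p⊆q⇒∣p∣≤∣q∣ λ x∈ →
        let x∈N , x∈Q = x∈p∩q⁻ (N U) Q x∈ in x∈p∩q⁺ (x∈N , x∈p∩q⁺ (N-mono U⊆T x∈N , x∈Q)))

      ∣P∩∁T∣≤k : ∣ P ∩ ∁ T ∣ ℕ.≤ k
      ∣P∩∁T∣≤k = let t , t∈T = 0<∣p∣⇒Nonempty (ℕ.≤-trans (s≤s z≤n) violated) in
        ℕ.s≤s⁻¹ (ℕ.≤-trans (∣p∩∁q∣<∣p∣ (T⊆P t∈T) t∈T) ∣P∣≤1+k)

      tight : ∣ N T ∩ Q ∣ ℕ.≤ ∣ T ∣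
      -- `Q` has only `q` beyond `Q′`, and the violation leaves room for exactly that one extra
      -- neighbour.
      tight = begin
        ∣ N T ∩ Q ∣                     ≤⟨ p⊆q⇒∣p∣≤∣q∣ covered ⟩
        ∣ ⁅ q ⁆ ∪ (N T ∩ Q′) ∣          ≤⟨ ∣p∪q∣≤∣p∣+∣q∣ ⁅ q ⁆ _ ⟩
        ∣ ⁅ q ⁆ ∣ ℕ.+ ∣ N T ∩ Q′ ∣      ≡⟨ cong (ℕ._+ ∣ N T ∩ Q′ ∣) (∣⁅x⁆∣≡1 q) ⟩
        suc ∣ N T ∩ Q′ ∣                ≤⟨ violated ⟩
        ∣ T ∣                           ∎
        where
        open ℕ.≤-Reasoning
        covered : N T ∩ Q ⊆ ⁅ q ⁆ ∪ (N T ∩ Q′)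
        covered = subst (λ r → N T ∩ Q ⊆ ⁅ q ⁆ ∪ r) (∩-assoc (N T) Q _) (p⊆q∪[p∩∁q] (N T ∩ Q) ⁅ q ⁆)

  hall : ∀ P Q → HallCondition P Q → MatchableInto P Q
  hall P Q = hall-bounded ∣ P ∣ P Q ℕ.≤-refl

  -- Matchings as edge sets

  joins? : ∀ e u v → Dec (Joins e u v)
  joins? e u v = ≡-dec _≟_ _≟_ (ends e) (u , v) ⊎-dec ≡-dec _≟_ _≟_ (ends e) (v , u)

  ends-ordered : ∀ e → proj₁ (ends e) < proj₂ (ends e) × Adj (proj₁ (ends e)) (proj₂ (ends e))
  ends-ordered e = proj₂ (∈-filter⁻ _ {xs = cartesianProduct (allFin n) (allFin n)} (∈-lookup {xs = edges} e))

  edges-unique : Unique edges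
  edges-unique = filter⁺ _ (cartesianProduct⁺ (allFin⁺ n) (allFin⁺ n))

  edge : ∀ {u v} → u < v → Adj u v → ∃[ e ] ends e ≡ (u , v)
  edge u<v uv = index uv∈ , sym (lookup-index uv∈)
    where uv∈ = ∈-filter⁺ _ (∈-cartesianProduct⁺ (∈-allFin _) (∈-allFin _)) (u<v , uv)

  adj⇒joined : ∀ {u v} → Adj u v → ∃[ e ] Joins e u v
  adj⇒joined {u} {v} uv with <-cmp u v
  ... | tri< u<v _ _ = let e , eq = edge u<v uv in e , inj₁ eq
  ... | tri≈ _ u≡v _ = contradiction uv (irrefl u≡v)
  ... | tri> _ _ v<u = let e , eq = edge v<u (symm uv) in e , inj₂ eq

  ordered : ∀ {e u v} → ends e ≡ (u , v) → u < v
  ordered {e} eq = subst (λ (u , v) → u < v) eq (proj₁ (ends-ordered e))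

  -- With equal orientations the list of edges, having no repetitions, determines the index;
  -- opposite orientations would give both `u < v` and `v < u`.
  joins-unique : ∀ {e e′ u v} → Joins e u v → Joins e′ u v → e ≡ e′
  joins-unique (inj₁ eq) (inj₁ eq′) = lookup-injective edges-unique _ _ (trans eq (sym eq′))
  joins-unique (inj₂ eq) (inj₂ eq′) = lookup-injective edges-unique _ _ (trans eq (sym eq′))
  joins-unique {e} {e′} (inj₁ eq) (inj₂ eq′) = contradiction (ordered {e′} eq′) (<-asym (ordered {e} eq))
  joins-unique {e} {e′} (inj₂ eq) (inj₁ eq′) = contradiction (ordered {e} eq) (<-asym (ordered {e′} eq′))

  joins-incident⁻ : ∀ {e u v x} → Joins e u v → Incident x e → x ≡ u ⊎ x ≡ v
  joins-incident⁻ (inj₁ eq) (inj₁ x≡) = inj₁ (trans x≡ (cong proj₁ eq))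
  joins-incident⁻ (inj₁ eq) (inj₂ x≡) = inj₂ (trans x≡ (cong proj₂ eq))
  joins-incident⁻ (inj₂ eq) (inj₁ x≡) = inj₂ (trans x≡ (cong proj₁ eq))
  joins-incident⁻ (inj₂ eq) (inj₂ x≡) = inj₁ (trans x≡ (cong proj₂ eq))

  joins-incidentˡ : ∀ {e u v} → Joins e u v → Incident u e
  joins-incidentˡ (inj₁ eq) = inj₁ (sym (cong proj₁ eq))
  joins-incidentˡ (inj₂ eq) = inj₂ (sym (cong proj₂ eq))

  module _ {P : Subset n} (m : MatchableInto P (∁ P)) where
    private
      open MatchableInto m renaming (partner to f)

      f∉P : ∀ {p} → p ∈ P → f p ∉ P
      f∉P p∈ = x∈∁p⇒x∉p (into p∈)

      chosen? : ∀ e → Dec (∃[ p ] (p ∈ P × Joins e p (f p)))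
      chosen? e = any? λ p → (p ∈? P) ×-dec joins? e p (f p)

      -- Here it matters that the target is `∁ P`: no vertex is both a member of `P` and a partner,
      -- which excludes the mixed cases.
      same : ∀ {p p′ x} → p ∈ P → p′ ∈ P → x ≡ p ⊎ x ≡ f p → x ≡ p′ ⊎ x ≡ f p′ → p ≡ p′
      same p∈ p′∈ (inj₁ eq) (inj₁ eq′) = trans (sym eq) eq′
      same p∈ p′∈ (inj₁ eq) (inj₂ eq′) = contradiction (subst (_∈ P) (trans (sym eq) eq′) p∈) (f∉P p′∈)
      same p∈ p′∈ (inj₂ eq) (inj₁ eq′) = contradiction (subst (_∈ P) (trans (sym eq′) eq) p′∈) (f∉P p∈)
      same p∈ p′∈ (inj₂ eq) (inj₂ eq′) = injective p∈ p′∈ (trans (sym eq) eq′)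

    matching : EdgeSet
    matching = Vec.tabulate (does ∘ chosen?)

    matching-isMatching : IsMatching matching
    matching-isMatching e e′ e∈ e′∈ v ve ve′
      with ∈-tabulate⁻ chosen? e∈ | ∈-tabulate⁻ chosen? e′∈
    ... | p , p∈ , j | p′ , p′∈ , j′ with same p∈ p′∈ (joins-incident⁻ j ve) (joins-incident⁻ j′ ve′)
    ...   | refl = joins-unique j j′

    matching-joins : ∀ {p} → p ∈ P → ∃[ e ] (e ∈ matching × Joins e p (f p))
    matching-joins p∈ = let e , j = adj⇒joined (adjacent p∈) in e , ∈-tabulate⁺ chosen? (_ , p∈ , j) , j

    ∣P∣≤μ : ∣ P ∣ ℕ.≤ μ
    ∣P∣≤μ = ℕ.≤-trans
      -- Membership in `P` is built into the relation because `f` is known to be injective only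
      -- there.
      (∣p∣≤∣q∣-via-leftUnique (λ p e → p ∈ P × Joins e p (f p))
        (λ p∈ → let e , e∈ , j = matching-joins p∈ in e , e∈ , p∈ , j)
        (λ (p∈ , j) (p′∈ , j′) → same p∈ p′∈ (joins-incident⁻ j (joins-incidentˡ j)) (joins-incident⁻ j′ (joins-incidentˡ j))))
      (∣X∣≤maxSize isMatching? matching-isMatching)

  -- `∁ I` is a vertex cover: each edge of a maximum matching has an end outside `I`, and distinct
  -- matching edges have distinct ends.
  μ≤∣∁I∣ : ∀ {I} → Independent I → μ ℕ.≤ ∣ ∁ I ∣
  μ≤∣∁I∣ {I} indI
    with maxSize-attained isMatching? (λ e f e∈ → contradiction e∈ ∉⊥)
  ... | M , isM , ∣M∣≡μ = subst (ℕ._≤ ∣ ∁ I ∣) ∣M∣≡μ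
    (∣p∣≤∣q∣-via-leftUnique (λ e v → e ∈ M × Incident v e) uncovered
      (λ (e∈ , ve) (e′∈ , ve′) → isM _ _ e∈ e′∈ _ ve ve′))
    where
    uncovered : ∀ {e} → e ∈ M → ∃[ v ] (v ∈ ∁ I × e ∈ M × Incident v e)
    uncovered {e} e∈ with proj₁ (ends e) ∈? I
    ... | no  u∉I = _ , x∉p⇒x∈∁p u∉I , e∈ , inj₁ refl
    ... | yes u∈I = _ , x∉p⇒x∈∁p (λ v∈I → indI _ _ u∈I v∈I (proj₂ (ends-ordered e))) , e∈ , inj₂ refl

  -- The exchanged set `T ∪ (I ∩ ∁ (N T))` is independent, hence no larger than `I`; the part common
  -- to both cancels.
  independent-hall : ∀ {I T} → Independent I → ∣ I ∣ ≡ α → Independent T → T ⊆ ∁ I → ∣ T ∣ ℕ.≤ ∣ N T ∩ I ∣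
  independent-hall {I} {T} indI ∣I∣≡α indT T⊆∁I = ℕ.+-cancelʳ-≤ ∣ I ∩ ∁ (N T) ∣ _ _ (begin
    ∣ T ∣ ℕ.+ ∣ I ∩ ∁ (N T) ∣               ≡⟨ disjoint⇒∣p∪q∣≡∣p∣+∣q∣ T _ (λ x∈T x∈ → x∈∁p⇒x∉p (T⊆∁I x∈T) (p∩q⊆p I _ x∈)) ⟨
    ∣ T ∪ (I ∩ ∁ (N T)) ∣                   ≤⟨ ∣X∣≤maxSize independent? (independent-exchange T I indT indI) ⟩
    α                                       ≡⟨ ∣I∣≡α ⟨
    ∣ I ∣                                   ≡⟨ ∣p∣≡∣p∩q∣+∣p∩∁q∣ I (N T) ⟩
    ∣ I ∩ N T ∣ ℕ.+ ∣ I ∩ ∁ (N T) ∣         ≡⟨ cong (λ r → ∣ r ∣ ℕ.+ ∣ I ∩ ∁ (N T) ∣) (∩-comm I (N T)) ⟩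
    ∣ N T ∩ I ∣ ℕ.+ ∣ I ∩ ∁ (N T) ∣         ∎)
    where open ℕ.≤-Reasoning

-- Exchange of the two sides and decomposition of sets along them

flip : ∀ {n} → BipartiteGraph n → BipartiteGraph n
flip G = record
  { graph         = graph
  ; A             = B
  ; B             = A
  ; A-nonempty    = B-nonempty
  ; B-nonempty    = A-nonempty
  ; cover         = trans (∪-comm B A) cover
  ; disjoint      = trans (∩-comm B A) disjoint
  ; A-independent = B-independent
  ; B-independent = A-independent
  }
  where open BipartiteGraph G

module Sides {n} (G : BipartiteGraph n) where
  open BipartiteGraph G
  open GraphProperties graph

  A#B : Disjoint A B
  A#B x∈A x∈B = ∉⊥ (subst (_ ∈_) disjoint (x∈p∩q⁺ (x∈A , x∈B)))

  A⊎B : ∀ x → x ∈ A ⊎ x ∈ B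
  A⊎B x = x∈p∪q⁻ A B (subst (x ∈_) (sym cover) ∈⊤)

  adj-A⇒B : ∀ {u v} → Adj u v → u ∈ A → v ∈ B
  adj-A⇒B {u} {v} uv u∈A = [ (λ v∈A → contradiction uv (A-independent u v u∈A v∈A)) , id ]′ (A⊎B v)

  N⊆B : ∀ {X} → X ⊆ A → N X ⊆ B
  N⊆B X⊆A v∈ = let u , u∈ , vu = ∈N⁻ v∈ in adj-A⇒B (symm vu) (X⊆A u∈)

  split : ∀ X → (X ∩ A) ∪ (X ∩ B) ≡ X
  split X = trans (sym (∩-distribˡ-∪ X A B)) (trans (cong (X ∩_) cover) (∩-identityʳ X))

  ∣∪∣-sides : ∀ {X Y} → X ⊆ A → Y ⊆ B → ∣ X ∪ Y ∣ ≡ ∣ X ∣ ℕ.+ ∣ Y ∣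
  ∣∪∣-sides X⊆A Y⊆B = disjoint⇒∣p∪q∣≡∣p∣+∣q∣ _ _ λ x∈X x∈Y → A#B (X⊆A x∈X) (Y⊆B x∈Y)

  ∣∣-split : ∀ X → ∣ X ∣ ≡ ∣ X ∩ A ∣ ℕ.+ ∣ X ∩ B ∣
  ∣∣-split X = trans (cong ∣_∣ (sym (split X))) (∣∪∣-sides (p∩q⊆q X A) (p∩q⊆q X B))

-- Additivity of `d` over the sides and the critical sets

module BipartiteProperties {n} (G : BipartiteGraph n) where
  open BipartiteGraph G
  open GraphProperties graph
  open Sides G
  open Sides (flip G) using () renaming (adj-A⇒B to adj-B⇒A; N⊆B to N⊆A; ∣∪∣-sides to ∣∪∣-sides′)

  d-∪ : ∀ {X Y} → X ⊆ A → Y ⊆ B → d (X ∪ Y) ≡ d X + d Y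
  d-∪ {X} {Y} X⊆A Y⊆B = begin
    -- `N X` lies in `B` and `N Y` in `A`, so the neighbourhoods are counted by the flipped form of
    -- the size formula.
    + ∣ X ∪ Y ∣ ℤ.- + ∣ N (X ∪ Y) ∣                        ≡⟨ cong₂ (λ a b → + a ℤ.- + b) (∣∪∣-sides X⊆A Y⊆B)
                                                               (trans (cong ∣_∣ (N-∪ X Y)) (∣∪∣-sides′ (N⊆B X⊆A) (N⊆A Y⊆B))) ⟩
    (+ ∣ X ∣ + + ∣ Y ∣) ℤ.- (+ ∣ N X ∣ + + ∣ N Y ∣)        ≡⟨ interchange (+ ∣ X ∣) (+ ∣ Y ∣) (+ ∣ N X ∣) (+ ∣ N Y ∣) ⟩
    d X + d Y                                              ∎
    where
    open ≡-Reasoning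
    interchange : ∀ a b c e → (a + b) ℤ.- (c + e) ≡ (a ℤ.- c) + (b ℤ.- e)
    interchange = ℤ-Solver.solve-∀

  d-split : ∀ X → d X ≡ d (X ∩ A) + d (X ∩ B)
  d-split X = trans (cong d (sym (split X))) (d-∪ (p∩q⊆q X A) (p∩q⊆q X B))

  critical-exists : ∀ S → ∃[ X ] Critical S X
  critical-exists S = maxValue-attained (_⊆? S) d (λ x∈ → contradiction x∈ ∉⊥)

  d≤δ₀ : ∀ {S X} → X ⊆ S → d X ℤ.≤ δ₀ S
  d≤δ₀ {S} = fX≤maxValue (_⊆? S) d

  d≤d-c : ∀ X → d X ℤ.≤ d-c
  d≤d-c X = fX≤maxValue U? d _

  -- A `d`-critical set splits into two one-sided sets, which bounds `d-c` from above; the union of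
  -- an `A`-critical and a `B`-critical set bounds it from below.
  d-c≡δ₀A+δ₀B : d-c ≡ δ₀ A + δ₀ B
  d-c≡δ₀A+δ₀B with maxValue-attained U? d _ | critical-exists A | critical-exists B
  ... | U , _ , dU≡ | X , X⊆A , dX≡ | Y , Y⊆B , dY≡ = ℤ.≤-antisym
    (begin
      d-c                        ≡⟨ dU≡ ⟨
      d U                        ≡⟨ d-split U ⟩
      d (U ∩ A) + d (U ∩ B)      ≤⟨ ℤ.+-mono-≤ (d≤δ₀ (p∩q⊆q U A)) (d≤δ₀ (p∩q⊆q U B)) ⟩
      δ₀ A + δ₀ B                ∎)
    (begin
      δ₀ A + δ₀ B                ≡⟨ cong₂ _+_ dX≡ dY≡ ⟨
      d X + d Y                  ≡⟨ d-∪ X⊆A Y⊆B ⟨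
      d (X ∪ Y)                  ≤⟨ d≤d-c (X ∪ Y) ⟩
      d-c                        ∎)
    where open ℤ.≤-Reasoning

  ∪-dCritical : ∀ X Y → Critical A X → Critical B Y → DCritical (X ∪ Y)
  ∪-dCritical X Y (X⊆A , dX≡) (Y⊆B , dY≡) =
    trans (d-∪ X⊆A Y⊆B) (trans (cong₂ _+_ dX≡ dY≡) (sym d-c≡δ₀A+δ₀B))

  ∩A-critical : ∀ Z → DCritical Z → Critical A (Z ∩ A)
  ∩A-critical Z dZ≡ = p∩q⊆q Z A , +-tightˡ (d≤δ₀ (p∩q⊆q Z A)) (d≤δ₀ (p∩q⊆q Z B))
    (trans (sym (d-split Z)) (trans dZ≡ d-c≡δ₀A+δ₀B))

  -- The independence number from critical sets

  -- For `X ⊆ A` this is the largest independent set whose trace on `A` is `X`.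
  completion : Subset n → Subset n
  completion X = X ∪ (B ∩ ∁ (N X))

  completion-independent : ∀ {X} → X ⊆ A → Independent (completion X)
  completion-independent {X} X⊆A =
    independent-exchange X B (independent-⊆ X⊆A A-independent) B-independent

  ∣completion∣ : ∀ {X} → X ⊆ A → + ∣ completion X ∣ ≡ + ∣ B ∣ + d X
  ∣completion∣ {X} X⊆A = begin
    + ∣ completion X ∣                                  ≡⟨ cong +_ (∣∪∣-sides X⊆A (p∩q⊆p B _)) ⟩
    -- Adding and subtracting `∣ N X ∣` completes `B ∩ ∁ (N X)` to all of `B`, since `N X ⊆ B`.
    + ∣ X ∣ + + ∣ B ∩ ∁ (N X) ∣                         ≡⟨ insert (+ ∣ X ∣) (+ ∣ B ∩ ∁ (N X) ∣) (+ ∣ N X ∣) ⟩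
    (+ ∣ N X ∣ + + ∣ B ∩ ∁ (N X) ∣) + d X               ≡⟨ cong (λ r → (+ ∣ r ∣ + + ∣ B ∩ ∁ (N X) ∣) + d X) B∩N≡N ⟨
    (+ ∣ B ∩ N X ∣ + + ∣ B ∩ ∁ (N X) ∣) + d X           ≡⟨ cong (λ r → + r + d X) (∣p∣≡∣p∩q∣+∣p∩∁q∣ B (N X)) ⟨
    + ∣ B ∣ + d X                                       ∎
    where
    open ≡-Reasoning
    insert : ∀ x r c → x + r ≡ (c + r) + (x ℤ.- c)
    insert = ℤ-Solver.solve-∀
    B∩N≡N : B ∩ N X ≡ N X
    B∩N≡N = ⊆-antisym (p∩q⊆q B (N X)) (λ x∈ → x∈p∩q⁺ (N⊆B X⊆A x∈ , x∈))

  -- Upper bound: for independent `I`, the sets `I ∩ B` and `N (I ∩ A)` are disjoint inside `B`, so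
  -- the excess of `∣ I ∣` over `∣ B ∣` is at most `d (I ∩ A)`. The completion of a critical set
  -- attains the bound.
  α≡∣B∣+δ₀A : + α ≡ + ∣ B ∣ + δ₀ A
  α≡∣B∣+δ₀A with maxSize-attained independent? ⊥-independent | critical-exists A
  ... | I , indI , ∣I∣≡α | X , X⊆A , dX≡ = ℤ.≤-antisym
    (begin
      + α                                              ≡⟨ cong +_ ∣I∣≡α ⟨
      + ∣ I ∣                                          ≡⟨ cong +_ (∣∣-split I) ⟩
      + ∣ I ∩ A ∣ + + ∣ I ∩ B ∣                        ≡⟨ insert (+ ∣ I ∩ A ∣) (+ ∣ I ∩ B ∣) (+ ∣ N (I ∩ A) ∣) ⟩
      (+ ∣ I ∩ B ∣ + + ∣ N (I ∩ A) ∣) + d (I ∩ A)      ≤⟨ ℤ.+-mono-≤ (ℤ.+≤+ fits) (d≤δ₀ (p∩q⊆q I A)) ⟩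
      + ∣ B ∣ + δ₀ A                                   ∎)
    (begin
      + ∣ B ∣ + δ₀ A                                   ≡⟨ cong (_+_ (+ ∣ B ∣)) dX≡ ⟨
      + ∣ B ∣ + d X                                    ≡⟨ ∣completion∣ X⊆A ⟨
      + ∣ completion X ∣                               ≤⟨ ℤ.+≤+ (∣X∣≤maxSize independent? (completion-independent X⊆A)) ⟩
      + α                                              ∎)
    where
    open ℤ.≤-Reasoning
    insert : ∀ a b c → a + b ≡ (b + c) + (a ℤ.- c)
    insert = ℤ-Solver.solve-∀
    apart : Disjoint (I ∩ B) (N (I ∩ A))
    apart x∈ x∈N = let u , u∈ , xu = ∈N⁻ x∈N in
      indI _ u (p∩q⊆p I B x∈) (p∩q⊆p I A u∈) xu
    fits : ∣ I ∩ B ∣ ℕ.+ ∣ N (I ∩ A) ∣ ℕ.≤ ∣ B ∣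
    fits = subst (ℕ._≤ ∣ B ∣) (disjoint⇒∣p∪q∣≡∣p∣+∣q∣ _ _ apart)
      (p⊆q⇒∣p∣≤∣q∣ (∪-lub (p∩q⊆q I B) (N⊆B (p∩q⊆q I A))))

  -- Matching the complement of a maximum independent set, and the matching number

  maximum-hall : ∀ {I} → Independent I → ∣ I ∣ ≡ α → HallCondition (∁ I) I
  maximum-hall {I} indI ∣I∣≡α T T⊆∁I = begin
    ∣ T ∣                                              ≡⟨ ∣∣-split T ⟩
    ∣ T ∩ A ∣ ℕ.+ ∣ T ∩ B ∣                            ≤⟨ ℕ.+-mono-≤ (half A A-independent) (half B B-independent) ⟩
    -- The two neighbourhoods lie on opposite sides, so their sizes add up without overlap.
    ∣ N (T ∩ A) ∩ I ∣ ℕ.+ ∣ N (T ∩ B) ∩ I ∣            ≡⟨ ∣∪∣-sides′ (N⊆B (p∩q⊆q T A) ∘ p∩q⊆p _ I) (N⊆A (p∩q⊆q T B) ∘ p∩q⊆p _ I) ⟨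
    ∣ (N (T ∩ A) ∩ I) ∪ (N (T ∩ B) ∩ I) ∣              ≡⟨ cong ∣_∣ (∩-distribʳ-∪ I (N (T ∩ A)) (N (T ∩ B))) ⟨
    ∣ (N (T ∩ A) ∪ N (T ∩ B)) ∩ I ∣                    ≡⟨ cong (λ r → ∣ r ∩ I ∣) (N-∪ (T ∩ A) (T ∩ B)) ⟨
    ∣ N ((T ∩ A) ∪ (T ∩ B)) ∩ I ∣                      ≡⟨ cong (λ r → ∣ N r ∩ I ∣) (split T) ⟩
    ∣ N T ∩ I ∣                                        ∎
    where
    open ℕ.≤-Reasoning
    half : ∀ S → Independent S → ∣ T ∩ S ∣ ℕ.≤ ∣ N (T ∩ S) ∩ I ∣
    half S indS = independent-hall indI ∣I∣≡α (independent-⊆ (p∩q⊆q T S) indS) (T⊆∁I ∘ p∩q⊆p T S)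

  -- The target `I` is written `∁ (∁ I)` to fit the passage to edge sets, which expects a matching
  -- of a set into its complement.
  maximum-matchable : ∀ {I} → Independent I → ∣ I ∣ ≡ α → MatchableInto (∁ I) (∁ (∁ I))
  maximum-matchable indI ∣I∣≡α = matchable-mono id (λ x∈I → x∉p⇒x∈∁p (x∈p⇒x∉∁p x∈I))
    (hall _ _ (maximum-hall indI ∣I∣≡α))

  -- For a maximum independent `I`, `∁ I` is a vertex cover and so bounds `μ` from above, while
  -- Hall's theorem matches all of it and bounds `μ` from below.
  α+μ≡∣A∣+∣B∣ : α ℕ.+ μ ≡ ∣ A ∣ ℕ.+ ∣ B ∣
  α+μ≡∣A∣+∣B∣ with maxSize-attained independent? ⊥-independent
  ... | I , indI , ∣I∣≡α = begin
    α ℕ.+ μ               ≡⟨ cong₂ ℕ._+_ (sym ∣I∣≡α) (ℕ.≤-antisym (μ≤∣∁I∣ indI) (∣P∣≤μ (maximum-matchable indI ∣I∣≡α))) ⟩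
    ∣ I ∣ ℕ.+ ∣ ∁ I ∣     ≡⟨ disjoint⇒∣p∪q∣≡∣p∣+∣q∣ I (∁ I) x∈p⇒x∉∁p ⟨
    ∣ I ∪ ∁ I ∣           ≡⟨ cong ∣_∣ (trans (p∪∁p≡⊤ I) (sym cover)) ⟩
    ∣ A ∪ B ∣             ≡⟨ ∣∪∣-sides id id ⟩
    ∣ A ∣ ℕ.+ ∣ B ∣       ∎
    where open ≡-Reasoning

  ∣A∣≡μ+δ₀A : + ∣ A ∣ ≡ + μ + δ₀ A
  ∣A∣≡μ+δ₀A = ∙-cancelˡ ℤ.+-0-abelianGroup (+ ∣ B ∣) _ _ (begin
    + ∣ B ∣ + + ∣ A ∣            ≡⟨ ℤ.+-comm (+ ∣ B ∣) (+ ∣ A ∣) ⟩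
    + ∣ A ∣ + + ∣ B ∣            ≡⟨ cong +_ α+μ≡∣A∣+∣B∣ ⟨
    + α + + μ                    ≡⟨ cong (_+ + μ) α≡∣B∣+δ₀A ⟩
    (+ ∣ B ∣ + δ₀ A) + + μ       ≡⟨ rotate (+ ∣ B ∣) (δ₀ A) (+ μ) ⟩
    + ∣ B ∣ + (+ μ + δ₀ A)       ∎)
    where
    open ≡-Reasoning
    rotate : ∀ b e m → (b + e) + m ≡ b + (m + e)
    rotate = ℤ-Solver.solve-∀

  -- Matchings from `N X` into a critical `X`

  completion-saturates : ∀ {X} → X ⊆ A → (m : MatchableInto (∁ (completion X)) (∁ (∁ (completion X)))) →
    MatchesInto (matching m) (N X) X
  completion-saturates {X} X⊆A m = matching-isMatching m , λ p p∈N →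
    partner p , partner∈X p∈N , matching-joins m (N⊆∁I p∈N)
    where
    open MatchableInto m
    -- `N X` lies in `B`, so it misses `X`, and it misses the other part of the completion by
    -- construction.
    N⊆∁I : N X ⊆ ∁ (completion X)
    N⊆∁I p∈N = x∉p⇒x∈∁p λ p∈I → [ (λ p∈X → A#B (X⊆A p∈X) (N⊆B X⊆A p∈N))
                                 , (λ p∈ → x∈∁p⇒x∉p (proj₂ (x∈p∩q⁻ B _ p∈)) p∈N) ]′ (x∈p∪q⁻ X _ p∈I)
    -- The partner of a vertex of `N X ⊆ B` lies in `A` and in the completion, which meets `A` only
    -- in `X`.
    partner∈X : ∀ {p} → p ∈ N X → partner p ∈ X
    partner∈X p∈N with x∈p∪q⁻ X _ (x∉∁p⇒x∈p (x∈∁p⇒x∉p (into (N⊆∁I p∈N))))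
    ... | inj₁ q∈X = q∈X
    ... | inj₂ q∈B = contradiction (p∩q⊆p B _ q∈B)
                       (A#B (adj-B⇒A (adjacent (N⊆∁I p∈N)) (N⊆B X⊆A p∈N)))

  critical-matching : ∀ X → Critical A X → ∃[ M ] MatchesInto M (N X) X
  critical-matching X (X⊆A , dX≡) = _ , completion-saturates X⊆A
    (maximum-matchable (completion-independent X⊆A) maximum)
    where
    maximum : ∣ completion X ∣ ≡ α
    -- Criticality gives the completion the size `∣ B ∣ + δ₀ A`, which is `α`.
    maximum = ℤ.+-injective (trans (∣completion∣ X⊆A) (trans (cong (_+_ (+ ∣ B ∣)) dX≡) (sym α≡∣B∣+δ₀A)))

theorem2p1 : (n : ℕ) (G : BipartiteGraph n) → let open BipartiteGraph G in
    (d-c ≡ δ₀ A + δ₀ B)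
    × ( (+ α ≡ + ∣ A ∣ + δ₀ B)
    × (+ ∣ A ∣ + δ₀ B ≡ + ∣ B ∣ + δ₀ A)
    × (+ ∣ B ∣ + δ₀ A ≡ + μ + δ₀ A + δ₀ B)
    × (+ μ + δ₀ A + δ₀ B ≡ + μ + d-c) )
    × (∀ X Y → Critical A X → Critical B Y → DCritical (X ∪ Y))
    × (∀ Z → DCritical Z → Independent Z → Critical A (Z ∩ A) × Critical B (Z ∩ B))
    × (∀ X → Critical A X ⊎ Critical B X → ∃[ M ] MatchesInto M (N X) X)
theorem2p1 n G =
    d-c≡δ₀A+δ₀B
  -- In the flipped graph `F` the sides trade names: this entry reads `α` as `∣ A ∣ + δ₀ B`, and
  -- `F.∣A∣≡μ+δ₀A` below gives `∣ B ∣` as `μ + δ₀ B`.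
  , ( F.α≡∣B∣+δ₀A
    , trans (sym F.α≡∣B∣+δ₀A) α≡∣B∣+δ₀A
    , trans (cong (_+ δ₀ A) F.∣A∣≡μ+δ₀A) (swap (+ μ) (δ₀ B) (δ₀ A))
    , trans (ℤ.+-assoc (+ μ) (δ₀ A) (δ₀ B)) (cong (_+_ (+ μ)) (sym d-c≡δ₀A+δ₀B)) )
  , ∪-dCritical
  , (λ Z crit _ → ∩A-critical Z crit , F.∩A-critical Z crit)
  , (λ X → [ critical-matching X , F.critical-matching X ]′)
  where
  open BipartiteGraph G
  open BipartiteProperties G
  module F = BipartiteProperties (flip G)
  swap : ∀ a b c → (a + b) + c ≡ (a + c) + b
  swap = ℤ-Solver.solve-∀
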